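{- Let $k\geq 2$ be an integer. For $n\geq 0$ let $f_k(n)$ denote the number of words over $[k]=\{1,\ldots,k\}$ of length $n$ with no repeated letter equal to the previous repeated letter (with $f_k(0)=1$), and let $F_k(x)=\sum_{n\geq 0}f_k(n)x^n$. Then \[F_k(x)=-\frac{(k-2)x^3+2(k-2)x^2+(k-3)x-1}{2(k-1)^2x^3+(k-1)(k-4)x^2+(3-2k)x+1}.\]
   Context: A word over $[k]$ of length $n$ is an element $w_1\cdots w_n$ of $[k]^n$. A repeated letter occurs at position $j$ (where $2\leq j\leq n$) if $w_j=w_{j-1}$; the repeated letter is then $w_j$. A word has no repeated letter equal to the previous repeated letter if, whenever $j<j'$ are two consecutive positions at which repeated letters occur (that is, $w_j=w_{j-1}$, $w_{j'}=w_{j'-1}$, and there is no $l$ with $j<l<j'$ and $w_l=w_{l-1}$), one has $w_j\neq w_{j'}$. For example, words containing $aaa$ as consecutive letters are not allowed, and neither is $aabaa$ for $a\ne b$. -}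

module Defs where

open import Data.Fin.Base using (Fin; toℕ; _<_)
open import Data.Fin.Properties using (_≟_; _<?_; all?; any?)
open import Data.Integer.Base using (ℤ; +_; -_; _+_; _-_; _*_; _^_; 0ℤ; 1ℤ; -1ℤ)
import Data.Integer.Properties as ℤ
open import Data.Integer.Tactic.RingSolver using (solve-∀)
open import Data.List.Base using (List; []; _∷_; [_]; length; filter; allFin; cartesianProductWith)
open import Data.Nat.Base using (ℕ; zero; suc)
import Data.Nat.Properties as ℕ
open import Data.Product.Base using (_×_; ∃-syntax)
open import Data.Vec.Base as Vec using (Vec; lookup)
open import Relation.Binary.PropositionalEquality
  using (_≡_; _≢_; _≗_; refl; trans; cong)
open import Relation.Nullary using (¬_; Dec)
open import Relation.Nullary.Decidable using (¬?; _×-dec_; _→-dec_)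

-- The alphabet {1, …, k} is represented by Fin k, and positions are counted
-- from 0.
Word : ℕ → ℕ → Set
Word k n = Vec (Fin k) n

words : ∀ k n → List (Word k n)
words k zero    = [ Vec.[] ]
words k (suc n) = cartesianProductWith Vec._∷_ (allFin k) (words k n)

module _ {k n : ℕ} (w : Word k n) where

  -- The witness i is the position preceding j, so the first position never
  -- carries a repeated letter.
  RepeatAt : Fin n → Set
  RepeatAt j = ∃[ i ] (suc (toℕ i) ≡ toℕ j × lookup w j ≡ lookup w i)

  ConsecutiveRepeats : Fin n → Fin n → Set
  ConsecutiveRepeats j j′ =
    j < j′ × RepeatAt j × RepeatAt j′ ×
    (∀ l → j < l × l < j′ → ¬ RepeatAt l)

  NoRepeatEqualToPrevious : Set
  NoRepeatEqualToPrevious =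
    ∀ j j′ → ConsecutiveRepeats j j′ → lookup w j ≢ lookup w j′

  repeatAt? : ∀ j → Dec (RepeatAt j)
  repeatAt? j = any? λ i →
    (suc (toℕ i) ℕ.≟ toℕ j) ×-dec (lookup w j ≟ lookup w i)

  consecutiveRepeats? : ∀ j j′ → Dec (ConsecutiveRepeats j j′)
  consecutiveRepeats? j j′ =
    (j <? j′) ×-dec repeatAt? j ×-dec repeatAt? j′ ×-dec
    all? λ l → ((j <? l) ×-dec (l <? j′)) →-dec ¬? (repeatAt? l)

  noRepeatEqualToPrevious? : Dec NoRepeatEqualToPrevious
  noRepeatEqualToPrevious? = all? λ j → all? λ j′ →
    consecutiveRepeats? j j′ →-dec ¬? (lookup w j ≟ lookup w j′)

f : ℕ → ℕ → ℕ
f k n = length (filter noRepeatEqualToPrevious? (words k n))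

-- A formal power series over ℤ is its sequence of coefficients; equality of
-- series is _≗_.
PowerSeries : Set
PowerSeries = ℕ → ℤ

tail : PowerSeries → PowerSeries
tail A n = A (suc n)

-- Polynomials, lowest-degree coefficient first.
polynomial : List ℤ → PowerSeries
polynomial []       n       = 0ℤ
polynomial (c ∷ cs) zero    = c
polynomial (c ∷ cs) (suc n) = polynomial cs n

infix  8 ⊖_
infixl 7 _⊛_

⊖_ : PowerSeries → PowerSeries
(⊖ A) n = - A n

-- Cauchy product, from A B = A₀ B + x (tail A) B.
_⊛_ : PowerSeries → PowerSeries → PowerSeries
(A ⊛ B) zero    = A 0 * B 0
(A ⊛ B) (suc n) = A 0 * B (suc n) + (tail A ⊛ B) n

-- Long division by a series with constant term 1:
-- N = N₀ D + x R, where R = tail N - N₀ tail D, so N / D = N₀ + x (R / D).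
quotient : (N D : PowerSeries) → D 0 ≡ 1ℤ → PowerSeries
quotient N D D₀≡1 zero    = N 0
quotient N D D₀≡1 (suc n) = quotient (λ i → tail N i - N 0 * tail D i) D D₀≡1 n

quotient-⊛ : ∀ N D (D₀≡1 : D 0 ≡ 1ℤ) → quotient N D D₀≡1 ⊛ D ≗ N
quotient-⊛ N D D₀≡1 zero    = trans (cong (N 0 *_) D₀≡1) (ℤ.*-identityʳ (N 0))
quotient-⊛ N D D₀≡1 (suc n) =
  trans (cong (_+_ (N 0 * D (suc n))) (quotient-⊛ _ D D₀≡1 n))
        (cancel (N 0 * D (suc n)) (N (suc n)))
  where
  cancel : ∀ a b → a + (b - a) ≡ b
  cancel = solve-∀

F : ℕ → PowerSeries
F k n = + f k n

numerator : ℕ → PowerSeries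
numerator k = polynomial (-1ℤ ∷ (+ k - + 3) ∷ + 2 * (+ k - + 2) ∷ (+ k - + 2) ∷ [])

denominator : ℕ → PowerSeries
denominator k = polynomial
  (1ℤ ∷ (+ 3 - + 2 * + k) ∷ (+ k - 1ℤ) * (+ k - + 4) ∷ + 2 * (+ k - 1ℤ) ^ 2 ∷ [])

{-# OPTIONS --safe #-}

-- Whether a letter may be prepended to an admissible word w depends only on the
-- first letter a and the first repeated letter b of w: the sole forbidden case
-- is prepending a when a = b.  Let t, e, p, z count, by length, the admissible
-- words, those with a = b, the nonempty words without repeats, and the empty
-- word.  Summing over the prepended letter gives
--   t′ + e = k t,   e′ + 2 e + p + 2 z = 2 t,   p′ + p = k (p + z),   z′ = 0,
-- where a prime denotes passing to the next length.  Eliminating e and p leaves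
-- a linear recurrence for t whose coefficients are those of the denominator.
module Submission where

open import Data.Fin.Base as Fin using (Fin; zero; suc)
import Data.Fin.Properties as Fin
open import Data.Integer.Base using (ℤ; +_; 0ℤ; 1ℤ; _-_)
  renaming (_+_ to _+ᶻ_; _*_ to _*ᶻ_; -_ to neg)
import Data.Integer.Properties as ℤ
open import Data.Integer.Tactic.RingSolver using (solve-∀)
open import Data.List.Base using (List; []; _∷_; _++_; map; length; filter; allFin; cartesianProductWith)
open import Data.List.Properties using (map-cong; map-++; map-tabulate; length-tabulate; map-∘)
open import Data.Nat.Base using (ℕ; zero; suc; _+_; _*_; _≤_; s≤s; z≤n)
open import Data.Nat.ListAction using (sum)
open import Data.Nat.ListAction.Properties using (sum-++)
import Data.Nat.Properties as ℕ
open import Data.Nat.Tactic.RingSolver using () renaming (solve-∀ to solve-∀ℕ)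
open import Data.Product.Base using (_×_; _,_; ∃-syntax; proj₁; proj₂)
open import Data.Vec.Base as Vec using (lookup)
open import Function.Base using (_∘_; id)
open import Relation.Binary.Definitions using (tri<; tri≈; tri>)
open import Relation.Binary.PropositionalEquality
  using (_≡_; _≢_; _≗_; refl; sym; trans; cong; cong₂; module ≡-Reasoning)
open import Relation.Nullary using (¬_; yes; no; contradiction)
open import Relation.Unary using (Decidable)
open import Defs

private variable
  A B C : Set
  k n : ℕ

-- Finite sums over lists and letters.

∑ : List A → (A → ℕ) → ℕ
∑ xs h = sum (map h xs)

∑-cong : ∀ (xs : List A) {g h} → g ≗ h → ∑ xs g ≡ ∑ xs h
∑-cong xs eq = cong sum (map-cong eq xs)

∑-+ : ∀ (xs : List A) g h → ∑ xs (λ x → g x + h x) ≡ ∑ xs g + ∑ xs h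
∑-+ []       g h = refl
∑-+ (x ∷ xs) g h = trans (cong (_+_ _) (∑-+ xs g h)) (interchange (g x) (h x) _ _)
  where
  interchange : ∀ a b c d → a + b + (c + d) ≡ a + c + (b + d)
  interchange = solve-∀ℕ

∑-* : ∀ (xs : List A) c h → ∑ xs (λ x → c * h x) ≡ c * ∑ xs h
∑-* []       c h = sym (ℕ.*-zeroʳ c)
∑-* (x ∷ xs) c h =
  trans (cong (_+_ _) (∑-* xs c h)) (sym (ℕ.*-distribˡ-+ c (h x) _))

∑-const : ∀ (xs : List A) c → ∑ xs (λ _ → c) ≡ length xs * c
∑-const []       c = refl
∑-const (x ∷ xs) c = cong (_+_ c) (∑-const xs c)

∑-swap : ∀ (xs : List A) (ys : List B) (h : A → B → ℕ) →
         ∑ xs (λ x → ∑ ys (h x)) ≡ ∑ ys (λ y → ∑ xs (λ x → h x y))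
∑-swap []       ys h = sym (trans (∑-const ys 0) (ℕ.*-zeroʳ (length ys)))
∑-swap (x ∷ xs) ys h =
  trans (cong (_+_ (∑ ys (h x))) (∑-swap xs ys h)) (sym (∑-+ ys (h x) _))

∑-cartesianProductWith : ∀ (_·_ : A → B → C) xs ys h →
  ∑ (cartesianProductWith _·_ xs ys) h ≡ ∑ xs (λ x → ∑ ys (λ y → h (x · y)))
∑-cartesianProductWith _·_ []       ys h = refl
∑-cartesianProductWith _·_ (x ∷ xs) ys h = begin
  sum (map h (map (x ·_) ys ++ rest))
    ≡⟨ cong sum (map-++ h (map (x ·_) ys) rest) ⟩
  sum (map h (map (x ·_) ys) ++ map h rest)
    ≡⟨ sum-++ (map h (map (x ·_) ys)) (map h rest) ⟩
  sum (map h (map (x ·_) ys)) + ∑ rest h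
    ≡⟨ cong₂ _+_ (cong sum (sym (map-∘ ys))) (∑-cartesianProductWith _·_ xs ys h) ⟩
  ∑ ys (λ y → h (x · y)) + ∑ xs (λ x → ∑ ys (λ y → h (x · y)))
    ∎
  where
  open ≡-Reasoning
  rest = cartesianProductWith _·_ xs ys

-- Only the values of `h` on and off `P` are prescribed, so the indicator may be computed by an
-- automaton instead of by `P?`.
length-filter-∑ : ∀ {P : A → Set} (P? : Decidable P) (h : A → ℕ) →
  (∀ x → P x → h x ≡ 1) → (∀ x → ¬ P x → h x ≡ 0) →
  ∀ xs → length (filter P? xs) ≡ ∑ xs h
length-filter-∑ P? h one nil []       = refl
length-filter-∑ P? h one nil (x ∷ xs) with P? x
... | yes p = cong₂ _+_ (sym (one x p)) (length-filter-∑ P? h one nil xs)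
... | no ¬p = cong₂ _+_ (sym (nil x ¬p)) (length-filter-∑ P? h one nil xs)

-- Kronecker delta; the test `c Fin.≟ a` has the same form as in `step`, so that one `with`
-- evaluates both.
δ : Fin k → Fin k → ℕ
δ a c with c Fin.≟ a
... | yes _ = 1
... | no  _ = 0

δ-suc : ∀ (a c : Fin k) → δ (suc a) (suc c) ≡ δ a c
δ-suc a c with c Fin.≟ a
... | yes _ = refl
... | no  _ = refl

∑-allFin-suc : ∀ k (h : Fin (suc k) → ℕ) →
               ∑ (allFin (suc k)) h ≡ h zero + ∑ (allFin k) (h ∘ suc)
∑-allFin-suc k h = cong (λ l → h zero + sum l)
  (trans (map-tabulate suc h) (sym (map-tabulate id (h ∘ suc))))

∑-letters-const : ∀ k c → ∑ (allFin k) (λ _ → c) ≡ k * c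
∑-letters-const k c =
  trans (∑-const (allFin k) c) (cong (_* c) (length-tabulate {n = k} id))

∑-δ : ∀ (a : Fin k) → ∑ (allFin k) (δ a) ≡ 1
∑-δ {suc k} zero = trans (∑-allFin-suc k (δ zero))
  (cong suc (trans (∑-letters-const k 0) (ℕ.*-zeroʳ k)))
∑-δ {suc k} (suc a) = trans (∑-allFin-suc k (δ (suc a)))
  (trans (∑-cong (allFin k) (δ-suc a)) (∑-δ a))

-- An automaton reading words from the right.

-- none a: nonempty without repeats, first letter a; same a: the first letter and
-- the first repeated letter are both a; diff a b: first letter a, first repeated
-- letter b.
data State (k : ℕ) : Set where
  bad   : State k
  empty : State k
  none  : Fin k → State k
  same  : Fin k → State k
  diff  : (a b : Fin k) → a ≢ b → State k

-- Prepending the first letter `a` again creates a new first repeat, of `a`, ahead of the old ones;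
-- this is fatal precisely when the old first repeated letter is also `a`. Any other letter leaves
-- the first repeated letter alone, so from `diff a b` the letter `b` leads to `same b`.
step : Fin k → State k → State k
step c bad            = bad
step c empty          = none c
step c (none a)       with c Fin.≟ a
... | yes _   = same a
... | no  _   = none c
step c (same a)       with c Fin.≟ a
... | yes _   = bad
... | no  c≢a = diff c a c≢a
step c (diff a b _)   with c Fin.≟ a | c Fin.≟ b
... | yes _ | _       = same a
... | no  _ | yes _   = same b
... | no  _ | no  c≢b = diff c b c≢b

state : Word k n → State k
state Vec.[]       = empty
state (c Vec.∷ w)  = step c (state w)

good isSame isNone isEmpty : State k → ℕ

good bad = 0
good _   = 1

isSame (same _) = 1
isSame _        = 0

isNone (none _) = 1
isNone _        = 0

isEmpty empty = 1
isEmpty _     = 0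

-- Transition sums over the prepended letter.

∑-complement : ∀ {g h : Fin k → ℕ} → (∀ c → g c + h c ≡ 1) →
               ∑ (allFin k) g + ∑ (allFin k) h ≡ k * 1
∑-complement {k} {g} {h} eq = trans (sym (∑-+ (allFin k) g h))
  (trans (∑-cong (allFin k) eq) (∑-letters-const k 1))

∑-complement-δ : ∀ (a : Fin k) {g : Fin k → ℕ} → (∀ c → g c + δ a c ≡ 1) →
                 ∑ (allFin k) g + 1 ≡ k * 1
∑-complement-δ {k} a {g} eq =
  trans (cong (_+_ (∑ (allFin k) g)) (sym (∑-δ a))) (∑-complement eq)

∑-vanishing : ∀ {g : Fin k → ℕ} → (∀ c → g c ≡ 0) → ∑ (allFin k) g ≡ 0
∑-vanishing {k} eq =
  trans (∑-cong (allFin k) eq) (trans (∑-letters-const k 0) (ℕ.*-zeroʳ k))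

∑-one : ∀ {g : Fin k → ℕ} → (∀ c → g c ≡ 1) → ∑ (allFin k) g ≡ k * 1
∑-one {k} eq = trans (∑-cong (allFin k) eq) (∑-letters-const k 1)

-- Every letter keeps a good state good, except `a` prepended to `same a`; the term `isSame s` makes
-- up for this one loss.
∑-good-step : ∀ (s : State k) →
  ∑ (allFin k) (λ c → good (step c s)) + isSame s ≡ k * good s
∑-good-step {k} bad = trans (ℕ.+-identityʳ _) (∑-letters-const k 0)
∑-good-step {k} empty = trans (ℕ.+-identityʳ _) (∑-one {k} λ _ → refl)
∑-good-step (none a) = trans (ℕ.+-identityʳ _) (∑-one pointwise)
  where
  pointwise : ∀ c → good (step c (none a)) ≡ 1
  pointwise c with c Fin.≟ a
  ... | yes _ = refl
  ... | no  _ = refl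
∑-good-step (same a) = ∑-complement-δ a pointwise
  where
  pointwise : ∀ c → good (step c (same a)) + δ a c ≡ 1
  pointwise c with c Fin.≟ a
  ... | yes _ = refl
  ... | no  _ = refl
∑-good-step (diff a b a≢b) = trans (ℕ.+-identityʳ _) (∑-one pointwise)
  where
  pointwise : ∀ c → good (step c (diff a b a≢b)) ≡ 1
  pointwise c with c Fin.≟ a | c Fin.≟ b
  ... | yes _ | _     = refl
  ... | no  _ | yes _ = refl
  ... | no  _ | no  _ = refl

-- From `diff a b` exactly the letters `a` and `b` lead to a `same` state, from `none a` only `a`,
-- from `same a` and `empty` no letter. The added terms fill the deficit from two.
∑-isSame-step : ∀ (s : State k) →
  ∑ (allFin k) (λ c → isSame (step c s)) + (2 * isSame s + (isNone s + 2 * isEmpty s)) ≡ 2 * good s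
∑-isSame-step {k} bad   = trans (ℕ.+-identityʳ _) (∑-vanishing {k} λ _ → refl)
∑-isSame-step {k} empty = cong (_+ 2) (∑-vanishing {k} λ _ → refl)
∑-isSame-step {k} (none a) =
  cong (_+ 1) (trans (∑-cong (allFin k) pointwise) (∑-δ a))
  where
  pointwise : ∀ c → isSame (step c (none a)) ≡ δ a c
  pointwise c with c Fin.≟ a
  ... | yes _ = refl
  ... | no  _ = refl
∑-isSame-step (same a) = cong (_+ 2) (∑-vanishing pointwise)
  where
  pointwise : ∀ c → isSame (step c (same a)) ≡ 0
  pointwise c with c Fin.≟ a
  ... | yes _ = refl
  ... | no  _ = refl
∑-isSame-step {k} (diff a b a≢b) = cong (_+ 0)
  (trans (∑-cong (allFin k) pointwise)
         (trans (∑-+ (allFin k) (δ a) (δ b)) (cong₂ _+_ (∑-δ a) (∑-δ b))))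
  where
  pointwise : ∀ c → isSame (step c (diff a b a≢b)) ≡ δ a c + δ b c
  pointwise c with c Fin.≟ a | c Fin.≟ b
  ... | yes p | yes q = contradiction (trans (sym p) q) a≢b
  ... | yes _ | no  _ = refl
  ... | no  _ | yes _ = refl
  ... | no  _ | no  _ = refl

-- To stay free of repeats is to avoid the first letter, which excludes one letter for a nonempty
-- word and none for the empty word.
∑-isNone-step : ∀ (s : State k) →
  ∑ (allFin k) (λ c → isNone (step c s)) + isNone s ≡ k * (isNone s + isEmpty s)
∑-isNone-step {k} bad = trans (ℕ.+-identityʳ _) (∑-letters-const k 0)
∑-isNone-step {k} empty = trans (ℕ.+-identityʳ _) (∑-letters-const k 1)
∑-isNone-step (none a) = ∑-complement-δ a pointwise
  where
  pointwise : ∀ c → isNone (step c (none a)) + δ a c ≡ 1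
  pointwise c with c Fin.≟ a
  ... | yes _ = refl
  ... | no  _ = refl
∑-isNone-step {k} (same a) =
  trans (ℕ.+-identityʳ _) (trans (∑-cong (allFin k) pointwise) (∑-letters-const k 0))
  where
  pointwise : ∀ c → isNone (step c (same a)) ≡ 0
  pointwise c with c Fin.≟ a
  ... | yes _ = refl
  ... | no  _ = refl
∑-isNone-step {k} (diff a b a≢b) =
  trans (ℕ.+-identityʳ _) (trans (∑-cong (allFin k) pointwise) (∑-letters-const k 0))
  where
  pointwise : ∀ c → isNone (step c (diff a b a≢b)) ≡ 0
  pointwise c with c Fin.≟ a | c Fin.≟ b
  ... | yes _ | _     = refl
  ... | no  _ | yes _ = refl
  ... | no  _ | no  _ = refl

isEmpty-step : ∀ (c : Fin k) s → isEmpty (step c s) ≡ 0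
isEmpty-step c bad      = refl
isEmpty-step c empty    = refl
isEmpty-step c (none a) with c Fin.≟ a
... | yes _ = refl
... | no  _ = refl
isEmpty-step c (same a) with c Fin.≟ a
... | yes _ = refl
... | no  _ = refl
isEmpty-step c (diff a b _) with c Fin.≟ a | c Fin.≟ b
... | yes _ | _     = refl
... | no  _ | yes _ = refl
... | no  _ | no  _ = refl

-- Counting words of a given length by state.

count : (State k → ℕ) → ℕ → ℕ
count {k} h n = ∑ (words k n) (h ∘ state)

-- A word of length `suc n` is a letter before a word of length `n`; once the two sums are
-- exchanged, the one-letter identity applies word by word.
count-suc : ∀ (g u v : State k → ℕ) →
  (∀ s → ∑ (allFin k) (λ c → g (step c s)) + u s ≡ v s) →
  ∀ n → count g (suc n) + count u n ≡ count v n
count-suc {k} g u v eq n = begin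
  count g (suc n) + count u n
    ≡⟨ cong (_+ count u n) (∑-cartesianProductWith Vec._∷_ (allFin k) (words k n) (g ∘ state)) ⟩
  ∑ (allFin k) (λ c → ∑ (words k n) (λ w → g (step c (state w)))) + count u n
    ≡⟨ cong (_+ count u n) (∑-swap (allFin k) (words k n) (λ c w → g (step c (state w)))) ⟩
  ∑ (words k n) (λ w → ∑ (allFin k) (λ c → g (step c (state w)))) + count u n
    ≡⟨ ∑-+ (words k n) _ (u ∘ state) ⟨
  ∑ (words k n) (λ w → ∑ (allFin k) (λ c → g (step c (state w))) + u (state w))
    ≡⟨ ∑-cong (words k n) (eq ∘ state) ⟩
  count v n
    ∎
  where open ≡-Reasoning

module _ (k : ℕ) where

  count-* : ∀ c (h : State k → ℕ) n → count (λ s → c * h s) n ≡ c * count h n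
  count-* c h n = ∑-* (words k n) c (h ∘ state)

  count-+ : ∀ (g h : State k → ℕ) n → count (λ s → g s + h s) n ≡ count g n + count h n
  count-+ g h n = ∑-+ (words k n) (g ∘ state) (h ∘ state)

  count-good-suc : ∀ n →
    count {k} good (suc n) + count {k} isSame n ≡ k * count {k} good n
  count-good-suc n = trans (count-suc good isSame _ ∑-good-step n) (count-* k good n)

  count-isSame-suc : ∀ n →
    count {k} isSame (suc n) + (2 * count {k} isSame n + (count {k} isNone n + 2 * count {k} isEmpty n))
      ≡ 2 * count {k} good n
  count-isSame-suc n = begin
    count {k} isSame (suc n) + (2 * count {k} isSame n + (count {k} isNone n + 2 * count {k} isEmpty n))
      ≡⟨ cong (_+_ (count {k} isSame (suc n))) (sym
           (trans (count-+ (λ s → 2 * isSame s) (λ s → isNone s + 2 * isEmpty s) n)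
             (cong₂ _+_ (count-* 2 isSame n)
               (trans (count-+ isNone (λ s → 2 * isEmpty s) n)
                 (cong (_+_ (count {k} isNone n)) (count-* 2 isEmpty n)))))) ⟩
    count {k} isSame (suc n) + count {k} (λ s → 2 * isSame s + (isNone s + 2 * isEmpty s)) n
      ≡⟨ count-suc isSame _ _ ∑-isSame-step n ⟩
    count {k} (λ s → 2 * good s) n
      ≡⟨ count-* 2 good n ⟩
    2 * count {k} good n
      ∎
    where open ≡-Reasoning

  count-isNone-suc : ∀ n →
    count {k} isNone (suc n) + count {k} isNone n ≡ k * (count {k} isNone n + count {k} isEmpty n)
  count-isNone-suc n = trans (count-suc isNone isNone _ ∑-isNone-step n)
    (trans (count-* k (λ s → isNone s + isEmpty s) n) (cong (k *_) (count-+ isNone isEmpty n)))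

  count-isEmpty-suc : ∀ n → count {k} isEmpty (suc n) ≡ 0
  count-isEmpty-suc n = ℕ.m+n≡0⇒m≡0 _
    (trans (count-suc isEmpty (λ _ → 0) (λ _ → 0)
             (λ s → trans (ℕ.+-identityʳ _) (∑-vanishing λ c → isEmpty-step c s)) n)
           (trans (∑-const (words k n) 0) (ℕ.*-zeroʳ (length (words k n)))))

-- Repeats under prepending a letter.

module _ {k n : ℕ} (w : Word k n) where

  FirstRepeatAt : Fin n → Set
  FirstRepeatAt j = RepeatAt w j × (∀ l → l Fin.< j → ¬ RepeatAt w l)

  FirstRepeatedLetter : Fin k → Set
  FirstRepeatedLetter b = ∃[ j ] (FirstRepeatAt j × lookup w j ≡ b)

  FirstRepeatAt-unique : ∀ {i j} → FirstRepeatAt i → FirstRepeatAt j → i ≡ j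
  FirstRepeatAt-unique {i} {j} (ri , mi) (rj , mj) with Fin.<-cmp i j
  ... | tri< i<j _ _ = contradiction ri (mj i i<j)
  ... | tri≈ _ i≡j _ = i≡j
  ... | tri> _ _ j<i = contradiction rj (mi j j<i)

¬RepeatAt-zero : ∀ (w : Word k (suc n)) → ¬ RepeatAt w zero
¬RepeatAt-zero w (_ , () , _)

RepeatAt-suc : ∀ c (w : Word k n) {j} → RepeatAt w j → RepeatAt (c Vec.∷ w) (suc j)
RepeatAt-suc c w (i , i+1≡j , eq) = suc i , cong suc i+1≡j , eq

-- From position 2 on, the preceding position lies inside `w`, so `c` is not involved.
RepeatAt-pred : ∀ c (w : Word k (suc n)) {j} →
                RepeatAt (c Vec.∷ w) (suc (suc j)) → RepeatAt w (suc j)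
RepeatAt-pred c w (suc i , i+1≡j , eq) = i , ℕ.suc-injective i+1≡j , eq

RepeatAt-pred-< : ∀ c (w : Word k n) {i j : Fin n} → i Fin.< j →
                  RepeatAt (c Vec.∷ w) (suc j) → RepeatAt w j
RepeatAt-pred-< {n = suc n} c w {j = suc j} _ = RepeatAt-pred c w

-- With `c` different from `a`, position 1 carries no repeat either, so every repeat comes from the
-- old word.
RepeatAt-pred-≢ : ∀ {c a} (w : Word k n) → c ≢ a → ∀ {j} →
                  RepeatAt (c Vec.∷ a Vec.∷ w) (suc j) → RepeatAt (a Vec.∷ w) j
RepeatAt-pred-≢ w c≢a {zero}  (zero , _ , a≡c) = contradiction (sym a≡c) c≢a
RepeatAt-pred-≢ w c≢a {suc j} r                = RepeatAt-pred _ (_ Vec.∷ w) r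

-- A position strictly between two shifted repeats lies beyond position 1, so `c` cannot create a
-- repeat there and the pair stays consecutive.
admissible-tail : ∀ c (w : Word k n) →
  NoRepeatEqualToPrevious (c Vec.∷ w) → NoRepeatEqualToPrevious w
admissible-tail c w ok j j′ (j<j′ , r , r′ , between) =
  ok (suc j) (suc j′) (s≤s j<j′ , RepeatAt-suc c w r , RepeatAt-suc c w r′ , between′)
  where
  between′ : ∀ l → suc j Fin.< l × l Fin.< suc j′ → ¬ RepeatAt (c Vec.∷ w) l
  between′ (suc l) (s≤s j<l , s≤s l<j′) r″ =
    between l (j<l , l<j′) (RepeatAt-pred-< c w {i = j} j<l r″)

admissible-∷-≢ : ∀ {c a} (w : Word k n) → c ≢ a →
  NoRepeatEqualToPrevious (a Vec.∷ w) → NoRepeatEqualToPrevious (c Vec.∷ a Vec.∷ w)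
admissible-∷-≢ w c≢a ok zero j′ (_ , r , _) =
  contradiction r (¬RepeatAt-zero (_ Vec.∷ _ Vec.∷ w))
admissible-∷-≢ {c = c} {a} w c≢a ok (suc j) (suc j′) (s≤s j<j′ , r , r′ , between) =
  ok j j′ (j<j′ , RepeatAt-pred-≢ w c≢a r , RepeatAt-pred-≢ w c≢a r′ ,
    λ l (j<l , l<j′) → between (suc l) (s≤s j<l , s≤s l<j′) ∘ RepeatAt-suc c (a Vec.∷ w))

first-∷-≢ : ∀ {c a b} (w : Word k n) → c ≢ a →
  FirstRepeatedLetter (a Vec.∷ w) b → FirstRepeatedLetter (c Vec.∷ a Vec.∷ w) b
first-∷-≢ {c = c} {a} w c≢a (j , (r , minimal) , eq) =
  suc j , (RepeatAt-suc c (a Vec.∷ w) r , λ where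
    zero    _         → ¬RepeatAt-zero (c Vec.∷ a Vec.∷ w)
    (suc l) (s≤s l<j) → minimal l l<j ∘ RepeatAt-pred-≢ w c≢a) , eq

first-∷-≡ : ∀ a (w : Word k n) → FirstRepeatedLetter (a Vec.∷ a Vec.∷ w) a
first-∷-≡ a w = suc zero , ((zero , refl , refl) , λ where
  zero    _         → ¬RepeatAt-zero (a Vec.∷ a Vec.∷ w)
  (suc l) (s≤s ())) , refl

-- The only new repeat is at position 1, so the only new consecutive pair joins it to the first
-- repeat of the old word.
admissible-∷-≡ : ∀ a (w : Word k n) → NoRepeatEqualToPrevious (a Vec.∷ w) →
  ¬ FirstRepeatedLetter (a Vec.∷ w) a → NoRepeatEqualToPrevious (a Vec.∷ a Vec.∷ w)
admissible-∷-≡ a w ok ¬first zero j′ (_ , r , _) =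
  contradiction r (¬RepeatAt-zero (a Vec.∷ a Vec.∷ w))
admissible-∷-≡ a w ok ¬first (suc zero) (suc zero) (s≤s () , _)
-- No repeat lies between, so `suc j` is the first repeat of the old word, and `a≡b` would make its
-- letter `a`.
admissible-∷-≡ a w ok ¬first (suc zero) (suc (suc j)) (_ , _ , r , between) a≡b =
  ¬first (suc j , (RepeatAt-pred a (a Vec.∷ w) r , λ where
    zero    _   → ¬RepeatAt-zero (a Vec.∷ w)
    (suc l) l<j → between (suc (suc l)) (s≤s (s≤s z≤n) , s≤s l<j) ∘ RepeatAt-suc a (a Vec.∷ w)) ,
    sym a≡b)
admissible-∷-≡ a w ok ¬first (suc (suc j)) (suc zero) (s≤s () , _)
admissible-∷-≡ a w ok ¬first (suc (suc j)) (suc (suc j′)) (s≤s j<j′ , r , r′ , between) =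
  ok (suc j) (suc j′)
    (j<j′ , RepeatAt-pred a (a Vec.∷ w) r , RepeatAt-pred a (a Vec.∷ w) r′ ,
     λ l (j<l , l<j′) → between (suc l) (s≤s j<l , s≤s l<j′) ∘ RepeatAt-suc a (a Vec.∷ w))

-- The new repeat at position 1 and the shifted first repeat of the old word violate the condition;
-- minimality of the latter makes them consecutive.
inadmissible-∷-≡ : ∀ a (w : Word k n) → FirstRepeatedLetter (a Vec.∷ w) a →
  ¬ NoRepeatEqualToPrevious (a Vec.∷ a Vec.∷ w)
inadmissible-∷-≡ a w (zero , (r , _) , _) _ = ¬RepeatAt-zero (a Vec.∷ w) r
inadmissible-∷-≡ {n = n} a w (suc j , (r , minimal) , eq) ok =
  ok (suc zero) (suc (suc j))
    (s≤s (s≤s z≤n) , (zero , refl , refl) , RepeatAt-suc a (a Vec.∷ w) r , between) (sym eq)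
  where
  between : ∀ l → suc {suc n} zero Fin.< l × l Fin.< suc (suc j) → ¬ RepeatAt (a Vec.∷ a Vec.∷ w) l
  between (suc (suc l)) (_ , s≤s l<j) = minimal (suc l) l<j ∘ RepeatAt-pred a (a Vec.∷ w)
  between (suc zero) (s≤s () , _)

no-repeats⇒admissible : ∀ (w : Word k n) → (∀ j → ¬ RepeatAt w j) → NoRepeatEqualToPrevious w
no-repeats⇒admissible w ¬r j j′ (_ , r , _) = contradiction r (¬r j)

-- Correctness of the automaton.

data Describes {k} : ∀ {n} → State k → Word k n → Set where
  bad   : ∀ {n} {w : Word k n} → ¬ NoRepeatEqualToPrevious w → Describes bad w
  empty : Describes empty Vec.[]
  none  : ∀ {n a} {w : Word k n} → (∀ j → ¬ RepeatAt (a Vec.∷ w) j) →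
          Describes (none a) (a Vec.∷ w)
  same  : ∀ {n a} {w : Word k n} → NoRepeatEqualToPrevious (a Vec.∷ w) →
          FirstRepeatedLetter (a Vec.∷ w) a → Describes (same a) (a Vec.∷ w)
  diff  : ∀ {n a b a≢b} {w : Word k n} → NoRepeatEqualToPrevious (a Vec.∷ w) →
          FirstRepeatedLetter (a Vec.∷ w) b → Describes (diff a b a≢b) (a Vec.∷ w)

-- `Describes` is the invariant of the run: a state records just the data on which the lemmas about
-- prepending depend.
step-describes : ∀ c {s} (w : Word k n) → Describes s w → Describes (step c s) (c Vec.∷ w)
step-describes c w (bad ¬ok) = bad (¬ok ∘ admissible-tail c w)
step-describes c w empty = none λ { zero → ¬RepeatAt-zero (c Vec.∷ Vec.[]) }
step-describes c (a Vec.∷ w) (none ¬r) with c Fin.≟ a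
... | yes refl = same (admissible-∷-≡ a w (no-repeats⇒admissible (a Vec.∷ w) ¬r)
                                      λ (j , (r , _) , _) → ¬r j r)
                      (first-∷-≡ a w)
... | no  c≢a  = none λ where
  zero    → ¬RepeatAt-zero (c Vec.∷ a Vec.∷ w)
  (suc j) → ¬r j ∘ RepeatAt-pred-≢ w c≢a
step-describes c (a Vec.∷ w) (same ok first) with c Fin.≟ a
... | yes refl = bad (inadmissible-∷-≡ a w first)
... | no  c≢a  = diff (admissible-∷-≢ w c≢a ok) (first-∷-≢ w c≢a first)
step-describes c (a Vec.∷ w) (diff {b = b} {a≢b} ok first) with c Fin.≟ a | c Fin.≟ b
... | yes refl | _ = same (admissible-∷-≡ a w ok (unequal first)) (first-∷-≡ a w)
  where
  unequal : FirstRepeatedLetter (a Vec.∷ w) b → ¬ FirstRepeatedLetter (a Vec.∷ w) a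
  -- A word has at most one first repeat, so if its letter were `a` as well as `b`, these would
  -- coincide.
  unequal (i , fi , i↦b) (j , fj , j↦a) with refl ← FirstRepeatAt-unique (a Vec.∷ w) fi fj =
    a≢b (trans (sym j↦a) i↦b)
... | no  c≢a  | yes refl = same (admissible-∷-≢ w c≢a ok) (first-∷-≢ w c≢a first)
... | no  c≢a  | no  c≢b  = diff (admissible-∷-≢ w c≢a ok) (first-∷-≢ w c≢a first)

state-describes : ∀ (w : Word k n) → Describes (state w) w
state-describes Vec.[]      = empty
state-describes (c Vec.∷ w) = step-describes c w (state-describes w)

admissible⇒good : ∀ {s} {w : Word k n} → Describes s w → NoRepeatEqualToPrevious w → good s ≡ 1
admissible⇒good (bad ¬ok)  ok = contradiction ok ¬ok
admissible⇒good empty      _  = refl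
admissible⇒good (none _)   _  = refl
admissible⇒good (same _ _) _  = refl
admissible⇒good (diff _ _) _  = refl

inadmissible⇒bad : ∀ {s} {w : Word k n} → Describes s w → ¬ NoRepeatEqualToPrevious w → good s ≡ 0
inadmissible⇒bad (bad _)             _   = refl
inadmissible⇒bad empty               ¬ok = contradiction (λ ()) ¬ok
inadmissible⇒bad {w = w} (none ¬r)   ¬ok = contradiction (no-repeats⇒admissible w ¬r) ¬ok
inadmissible⇒bad (same ok _)         ¬ok = contradiction ok ¬ok
inadmissible⇒bad (diff ok _)         ¬ok = contradiction ok ¬ok

f≡count-good : ∀ k n → f k n ≡ count {k} good n
f≡count-good k n = length-filter-∑ noRepeatEqualToPrevious? (good ∘ state)
  (λ w → admissible⇒good (state-describes w)) (λ w → inadmissible⇒bad (state-describes w))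
  (words k n)

-- Uniqueness of power series quotients.

⊛≗⇒≗quotient : ∀ A N D (D₀≡1 : D 0 ≡ 1ℤ) → A ⊛ D ≗ N → A ≗ quotient N D D₀≡1
⊛≗⇒≗quotient A N D D₀≡1 eq = go
  where
  A₀≡N₀ : A 0 ≡ N 0
  A₀≡N₀ = trans (sym (trans (cong (A 0 *ᶻ_) D₀≡1) (ℤ.*-identityʳ (A 0)))) (eq 0)

  isolate : ∀ a b → b ≡ (a +ᶻ b) - a
  isolate = solve-∀

  -- One step of long division: the tail of `A` times `D` is the remainder that `quotient` divides
  -- next.
  tail-eq : tail A ⊛ D ≗ λ i → tail N i - N 0 *ᶻ tail D i
  tail-eq n = trans (isolate (A 0 *ᶻ D (suc n)) _)
    (cong₂ _-_ (eq (suc n)) (cong (_*ᶻ D (suc n)) A₀≡N₀))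

  go : A ≗ quotient N D D₀≡1
  go zero    = A₀≡N₀
  go (suc n) = ⊛≗⇒≗quotient (tail A) _ D D₀≡1 tail-eq n

-- Elimination of the auxiliary counts over the integers.

transpose : ∀ a b c → a + b ≡ c → + a ≡ + c - + b
transpose a b _ refl = trans (isolate (+ a) (+ b)) (cong (_- + b) (sym (ℤ.pos-+ a b)))
  where
  isolate : ∀ x y → x ≡ (x +ᶻ y) - y
  isolate = solve-∀

minus-swap : ∀ b c {a} → a ≡ b - c → c ≡ b - a
minus-swap b c refl = identity b c
  where
  identity : ∀ b c → c ≡ b - (b - c)
  identity = solve-∀

minus-swap-+ : ∀ b c d {a} → a ≡ b - (c +ᶻ d) → d ≡ b - (c +ᶻ a)
minus-swap-+ b c d refl = identity b c d
  where
  identity : ∀ b c d → d ≡ b - (c +ᶻ (b - (c +ᶻ d)))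
  identity = solve-∀

-- The left-hand side is the difference of the two expressions for p₁.  The
-- factor (q - 1ℤ) *ᶻ ((q - 1ℤ) *ᶻ 1ℤ) is the unfolding of (q - 1ℤ) ^ 2.
recurrence : ∀ q {t₀ t₁ t₂ t₃ e₀ e₁ e₂ p₀ p₁} →
  e₀ ≡ q *ᶻ t₀ - t₁ → e₁ ≡ q *ᶻ t₁ - t₂ → e₂ ≡ q *ᶻ t₂ - t₃ →
  p₀ ≡ + 2 *ᶻ t₀ - (+ 2 *ᶻ e₀ +ᶻ e₁) → p₁ ≡ + 2 *ᶻ t₁ - (+ 2 *ᶻ e₁ +ᶻ e₂) →
  p₁ ≡ q *ᶻ p₀ - p₀ →
  neg t₀ *ᶻ (+ 2 *ᶻ ((q - 1ℤ) *ᶻ ((q - 1ℤ) *ᶻ 1ℤ))) +ᶻ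
  (neg t₁ *ᶻ ((q - 1ℤ) *ᶻ (q - + 4)) +ᶻ
  (neg t₂ *ᶻ (+ 3 - + 2 *ᶻ q) +ᶻ neg t₃ *ᶻ 1ℤ)) ≡ 0ℤ
recurrence q {t₀} {t₁} {t₂} {t₃} refl refl refl refl refl p₁≡ =
  trans (identity q t₀ t₁ t₂ t₃) (ℤ.i≡j⇒i-j≡0 (sym p₁≡))
  where
  identity : ∀ q t₀ t₁ t₂ t₃ →
    neg t₀ *ᶻ (+ 2 *ᶻ ((q - 1ℤ) *ᶻ ((q - 1ℤ) *ᶻ 1ℤ))) +ᶻ
    (neg t₁ *ᶻ ((q - 1ℤ) *ᶻ (q - + 4)) +ᶻ
    (neg t₂ *ᶻ (+ 3 - + 2 *ᶻ q) +ᶻ neg t₃ *ᶻ 1ℤ)) ≡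
    (q *ᶻ (+ 2 *ᶻ t₀ - (+ 2 *ᶻ (q *ᶻ t₀ - t₁) +ᶻ (q *ᶻ t₁ - t₂))) -
     (+ 2 *ᶻ t₀ - (+ 2 *ᶻ (q *ᶻ t₀ - t₁) +ᶻ (q *ᶻ t₁ - t₂)))) -
    (+ 2 *ᶻ t₁ - (+ 2 *ᶻ (q *ᶻ t₁ - t₂) +ᶻ (q *ᶻ t₂ - t₃)))
  identity = solve-∀

-- The empty word disturbs the recurrences at length 0, so the coefficients of degree 1 to 3, which
-- involve `t₀`, are computed from initial values. The left-hand sides are unfolded Cauchy products.
initial-coefficients : ∀ q {t₀ t₁ t₂ t₃ e₁ e₂ p₁} →
  t₀ ≡ + 1 → t₁ ≡ q → e₁ ≡ 0ℤ → p₁ ≡ q →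
  t₂ ≡ q *ᶻ t₁ - e₁ → t₃ ≡ q *ᶻ t₂ - e₂ → e₂ ≡ + 2 *ᶻ t₁ - (+ 2 *ᶻ e₁ +ᶻ p₁) →
  (neg t₀ *ᶻ (+ 3 - + 2 *ᶻ q) +ᶻ neg t₁ *ᶻ 1ℤ ≡ q - + 3) ×
  (neg t₀ *ᶻ ((q - 1ℤ) *ᶻ (q - + 4)) +ᶻ
    (neg t₁ *ᶻ (+ 3 - + 2 *ᶻ q) +ᶻ neg t₂ *ᶻ 1ℤ) ≡ + 2 *ᶻ (q - + 2)) ×
  (neg t₀ *ᶻ (+ 2 *ᶻ ((q - 1ℤ) *ᶻ ((q - 1ℤ) *ᶻ 1ℤ))) +ᶻ
    (neg t₁ *ᶻ ((q - 1ℤ) *ᶻ (q - + 4)) +ᶻ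
    (neg t₂ *ᶻ (+ 3 - + 2 *ᶻ q) +ᶻ neg t₃ *ᶻ 1ℤ)) ≡ q - + 2)
initial-coefficients q refl refl refl refl refl refl refl = i₁ q , i₂ q , i₃ q
  where
  i₁ : ∀ q → neg (+ 1) *ᶻ (+ 3 - + 2 *ᶻ q) +ᶻ neg q *ᶻ 1ℤ ≡ q - + 3
  i₁ = solve-∀
  i₂ : ∀ q → neg (+ 1) *ᶻ ((q - 1ℤ) *ᶻ (q - + 4)) +ᶻ
    (neg q *ᶻ (+ 3 - + 2 *ᶻ q) +ᶻ neg (q *ᶻ q - 0ℤ) *ᶻ 1ℤ) ≡ + 2 *ᶻ (q - + 2)
  i₂ = solve-∀
  i₃ : ∀ q → let t₂ = q *ᶻ q - 0ℤ in
    neg (+ 1) *ᶻ (+ 2 *ᶻ ((q - 1ℤ) *ᶻ ((q - 1ℤ) *ᶻ 1ℤ))) +ᶻ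
    (neg q *ᶻ ((q - 1ℤ) *ᶻ (q - + 4)) +ᶻ
    (neg t₂ *ᶻ (+ 3 - + 2 *ᶻ q) +ᶻ
     neg (q *ᶻ t₂ - (+ 2 *ᶻ q - (+ 2 *ᶻ 0ℤ +ᶻ q))) *ᶻ 1ℤ)) ≡ q - + 2
  i₃ = solve-∀

⊛-vanishing : ∀ A D n → D (suc n) ≡ 0ℤ → (tail A ⊛ D) n ≡ 0ℤ → (A ⊛ D) (suc n) ≡ 0ℤ
⊛-vanishing A D n D≡0 eq =
  cong₂ _+ᶻ_ (trans (cong (A 0 *ᶻ_) D≡0) (ℤ.*-zeroʳ (A 0))) eq

-- `denominator k` has degree 3, so the coefficient of degree `4 + n` begins with `n + 1` zero
-- products, peeled off by passing to tails.
⊛-denominator-vanishing : ∀ k A →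
  (∀ m → let D = denominator k in
     A (1 + m) *ᶻ D 3 +ᶻ (A (2 + m) *ᶻ D 2 +ᶻ (A (3 + m) *ᶻ D 1 +ᶻ A (4 + m) *ᶻ D 0)) ≡ 0ℤ) →
  ∀ n → (A ⊛ denominator k) (4 + n) ≡ 0ℤ
⊛-denominator-vanishing k A eq zero    = ⊛-vanishing A (denominator k) 3 refl (eq 0)
⊛-denominator-vanishing k A eq (suc n) = ⊛-vanishing A (denominator k) (4 + n) refl
  (⊛-denominator-vanishing k (tail A) (eq ∘ suc) n)

recurrences⇒⊛-denominator : ∀ k (T E P : ℕ → ℤ) →
  T 0 ≡ + 1 → T 1 ≡ + k → E 1 ≡ 0ℤ → P 1 ≡ + k →
  (∀ n → T (suc n) ≡ + k *ᶻ T n - E n) →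
  (∀ n → E (2 + n) ≡ + 2 *ᶻ T (suc n) - (+ 2 *ᶻ E (suc n) +ᶻ P (suc n))) →
  (∀ n → P (2 + n) ≡ + k *ᶻ P (suc n) - P (suc n)) →
  (⊖ T) ⊛ denominator k ≗ numerator k
recurrences⇒⊛-denominator k T E P T₀ T₁ E₁ P₁ T-suc E-suc P-suc = coefficient
  where
  initial = initial-coefficients (+ k) T₀ T₁ E₁ P₁ (T-suc 1) (T-suc 2) (E-suc 0)

  -- Solving for `E` and then for `P` turns `P-suc` into a relation among values of `T` alone.
  E≡ : ∀ n → E n ≡ + k *ᶻ T n - T (suc n)
  E≡ n = minus-swap (+ k *ᶻ T n) (E n) (T-suc n)

  P≡ : ∀ n → P (suc n) ≡ + 2 *ᶻ T (suc n) - (+ 2 *ᶻ E (suc n) +ᶻ E (2 + n))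
  P≡ n = minus-swap-+ (+ 2 *ᶻ T (suc n)) (+ 2 *ᶻ E (suc n)) (P (suc n)) (E-suc n)

  coefficient : (⊖ T) ⊛ denominator k ≗ numerator k
  coefficient 0 = cong (λ t → neg t *ᶻ 1ℤ) T₀
  coefficient 1 = proj₁ initial
  coefficient 2 = proj₁ (proj₂ initial)
  coefficient 3 = proj₂ (proj₂ initial)
  coefficient (suc (suc (suc (suc n)))) = ⊛-denominator-vanishing k (⊖ T)
    -- The offset 1 starts the recurrence at length 1, past the empty word.
    (λ m → recurrence (+ k) (E≡ (1 + m)) (E≡ (2 + m)) (E≡ (3 + m))
                      (P≡ m) (P≡ (1 + m)) (P-suc m)) n

-- Recurrences and initial values for the word counts.

module _ {k : ℕ} where

  sames nones : ℕ → ℤ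
  sames n = + count {k} isSame n
  nones n = + count {k} isNone n

  F-suc : ∀ n → F k (suc n) ≡ + k *ᶻ F k n - sames n
  F-suc n rewrite f≡count-good k (suc n) | f≡count-good k n =
    trans (transpose _ _ _ (count-good-suc k n)) (cong (_- sames n) (ℤ.pos-* k _))

  sames-suc : ∀ n → sames (2 + n) ≡ + 2 *ᶻ F k (suc n) - (+ 2 *ᶻ sames (suc n) +ᶻ nones (suc n))
  sames-suc n with eq ← count-isSame-suc k (suc n)
    rewrite count-isEmpty-suc k n
          | ℕ.+-identityʳ (count {k} isNone (suc n))
          | f≡count-good k (suc n) =
    trans (transpose _ _ _ eq)
      (cong₂ _-_ (ℤ.pos-* 2 (count {k} good (suc n)))
        (trans (ℤ.pos-+ (2 * count {k} isSame (suc n)) _)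
               (cong (_+ᶻ nones (suc n)) (ℤ.pos-* 2 (count {k} isSame (suc n))))))

  nones-suc : ∀ n → nones (2 + n) ≡ + k *ᶻ nones (suc n) - nones (suc n)
  nones-suc n with eq ← count-isNone-suc k (suc n)
    rewrite count-isEmpty-suc k n
          | ℕ.+-identityʳ (count {k} isNone (suc n)) =
    trans (transpose _ _ _ eq) (cong (_- nones (suc n)) (ℤ.pos-* k _))

  F₀ : F k 0 ≡ + 1
  F₀ = cong +_ (f≡count-good k 0)

  sames₁ : sames 1 ≡ 0ℤ
  -- At length 0 the empty word contributes 2 to both sides.
  sames₁ = transpose _ _ _ (count-isSame-suc k 0)

  F₁ : F k 1 ≡ + k
  F₁ = trans (F-suc 0) (trans (cong (λ t → + k *ᶻ t - 0ℤ) F₀) (simplify (+ k)))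
    where
    simplify : ∀ q → q *ᶻ + 1 - 0ℤ ≡ q
    simplify = solve-∀

  nones₁ : nones 1 ≡ + k
  nones₁ = trans (transpose _ _ _ (count-isNone-suc k 0))
    (cong +_ (trans (ℕ.+-identityʳ _) (ℕ.*-identityʳ k)))

  F-⊛-denominator : (⊖ F k) ⊛ denominator k ≗ numerator k
  F-⊛-denominator =
    recurrences⇒⊛-denominator k (F k) sames nones F₀ F₁ sames₁ nones₁ F-suc sames-suc nones-suc

theorem10 : (k : ℕ) → 2 ≤ k →
    F k ≗ ⊖ quotient (numerator k) (denominator k) refl
-- The quotient is identified with `⊖ F k`, so a double negation recovers `F k`.
theorem10 k _ n = trans (sym (ℤ.neg-involutive (F k n)))
  (cong neg (⊛≗⇒≗quotient (⊖ F k) (numerator k) (denominator k) refl F-⊛-denominator n))
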